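{- Let $k\ge 2$ and let $G$ and $H$ be $\Gamma_{\times k,t}$-external graphs with $\delta(G)\ge k$ and $\delta(H)\ge k$. Then \[ \Gamma_{\times k,t}(G\,\Box\,H)\ge\max\{\Gamma_{\times k,t}(G)\cdot|V(H)|,\ \Gamma_{\times k,t}(H)\cdot|V(G)|\}. \]
   Context: A set $S\subseteq V(G)$ is a $k$-tuple total dominating set ($k$TDS) of a graph $G$ with $\delta(G)\ge k$ if $|N_G(x)\cap S|\ge k$ for every $x\in V(G)$. The upper $k$-tuple total domination number $\Gamma_{\times k,t}(G)$ is the maximum cardinality of a minimal (with respect to inclusion) $k$TDS of $G$; a minimal $k$TDS of this cardinality is a $\Gamma_{\times k,t}$-set. For $v\in S$, a vertex $v'$ is a $k$-open private neighbor of $v$ with respect to $S$ if $v\in N_G(v')$ and $|N_G(v')\cap S|=k$; it is external if $v'\notin S$. A graph $G$ is $\Gamma_{\times k,t}$-external if it has a $\Gamma_{\times k,t}$-set $S$ such that every vertex of $S$ has an external $k$-open private neighbor with respect to $S$. The Cartesian product $G\,\Box\,H$ has vertex set $V(G)\times V(H)$, with $(g_1,h_1)\sim(g_2,h_2)$ iff either $g_1=g_2$ and $h_1h_2\in E(H)$, or $h_1=h_2$ and $g_1g_2\in E(G)$. -}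

module Defs where

open import Data.Fin.Base using (Fin; quotient; remainder)
open import Data.Fin.Properties using (all?) renaming (_≟_ to _≟ᶠ_)
open import Data.Fin.Subset
  using (Subset; inside; outside; ∣_∣; _∩_; _∈_; _∉_; _⊂_)
open import Data.Fin.Subset.Properties using (anySubset?; _⊂?_)
open import Data.List.Base using (List; []; _∷_; [_]; _++_; map; filter; allFin)
open import Data.List.Extrema.Nat using (max; min)
open import Data.Nat.Base using (ℕ; zero; suc; _*_; _≤_)
open import Data.Nat.Properties using (_≤?_)
open import Data.Product.Base using (_×_; _,_; ∃-syntax)
open import Data.Sum.Base using (_⊎_; inj₁; inj₂)
open import Data.Vec.Base using (tabulate) renaming ([] to []ᵥ; _∷_ to _∷ᵥ_)
open import Level using (0ℓ)
open import Relation.Binary.Core using (Rel)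
open import Relation.Binary.Definitions using (Decidable; Irreflexive; Symmetric)
open import Relation.Binary.PropositionalEquality using (_≡_; refl; sym)
open import Relation.Nullary using (¬_; Dec; does)
open import Relation.Nullary.Decidable using (map′; ¬?; _×-dec_; _⊎-dec_)

private
  variable
    m n : ℕ

-- Finite simple graphs with vertex set Fin n.
record Graph (n : ℕ) : Set₁ where
  field
    Adj        : Rel (Fin n) 0ℓ
    adj?       : Decidable Adj
    adj-sym    : Symmetric Adj
    adj-irrefl : Irreflexive _≡_ Adj

open Graph public

N : Graph n → Fin n → Subset n
N G x = tabulate λ y → does (adj? G x y)

degree : Graph n → Fin n → ℕ
degree G x = ∣ N G x ∣

-- Degrees are smaller than n, so the initial value n is irrelevant for a
-- graph with at least one vertex; the graph without vertices gets δ = 0.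
δ : Graph n → ℕ
δ {n} G = min n (map (degree G) (allFin n))

IsTDS : ℕ → Graph n → Subset n → Set
IsTDS k G S = ∀ x → k ≤ ∣ N G x ∩ S ∣

IsMinimalTDS : ℕ → Graph n → Subset n → Set
IsMinimalTDS k G S = IsTDS k G S × (∀ T → T ⊂ S → ¬ IsTDS k G T)

isTDS? : ∀ k (G : Graph n) S → Dec (IsTDS k G S)
isTDS? k G S = all? λ x → k ≤? ∣ N G x ∩ S ∣

isMinimalTDS? : ∀ k (G : Graph n) S → Dec (IsMinimalTDS k G S)
isMinimalTDS? k G S = isTDS? k G S ×-dec
  map′ (λ ∄T T T⊂S tds → ∄T (T , T⊂S , tds))
       (λ ∀T (T , T⊂S , tds) → ∀T T T⊂S tds)
       (¬? (anySubset? λ T → (T ⊂? S) ×-dec isTDS? k G T))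

subsets : ∀ n → List (Subset n)
subsets zero    = [ []ᵥ ]
subsets (suc n) =
  map (inside ∷ᵥ_) (subsets n) ++ map (outside ∷ᵥ_) (subsets n)

-- The upper k-tuple total domination number.  If δ G ≥ k, then the set of all
-- vertices is a kTDS, so a minimal one exists and the initial value 0 of the
-- maximum is irrelevant.
Γ : ℕ → Graph n → ℕ
Γ {n} k G = max 0 (map ∣_∣ (filter (isMinimalTDS? k G) (subsets n)))

IsΓ-set : ℕ → Graph n → Subset n → Set
IsΓ-set k G S = IsMinimalTDS k G S × ∣ S ∣ ≡ Γ k G

-- v′ is a k-open private neighbor of v with respect to S; meant for v ∈ S.
IsOpenPrivateNeighbor : ℕ → Graph n → Subset n → (v v′ : Fin n) → Set
IsOpenPrivateNeighbor k G S v v′ = v ∈ N G v′ × ∣ N G v′ ∩ S ∣ ≡ k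

IsExternal : ℕ → Graph n → Set
IsExternal k G =
  ∃[ S ] IsΓ-set k G S ×
    (∀ v → v ∈ S → ∃[ v′ ] IsOpenPrivateNeighbor k G S v v′ × v′ ∉ S)

-- The vertex (g , h) is encoded as Data.Fin.combine g h; quotient and
-- remainder recover g and h.
infixr 6 _□_

_□_ : Graph m → Graph n → Graph (m * n)
_□_ {m} {n} G H = record
  { Adj        = λ x y → (fst x ≡ fst y × Adj H (snd x) (snd y))
                       ⊎ (snd x ≡ snd y × Adj G (fst x) (fst y))
  ; adj?       = λ x y → ((fst x ≟ᶠ fst y) ×-dec adj? H (snd x) (snd y))
                   ⊎-dec ((snd x ≟ᶠ snd y) ×-dec adj? G (fst x) (fst y))
  ; adj-sym    = λ where
      (inj₁ (eq , a)) → inj₁ (sym eq , adj-sym H a)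
      (inj₂ (eq , a)) → inj₂ (sym eq , adj-sym G a)
  ; adj-irrefl = λ where
      refl (inj₁ (_ , a)) → adj-irrefl H refl a
      refl (inj₂ (_ , a)) → adj-irrefl G refl a
  }
  where
  fst : Fin (m * n) → Fin m
  fst = quotient n

  snd : Fin (m * n) → Fin n
  snd = remainder {m} n

-- If S is a Γ-set of G all of whose vertices have external private neighbors,
-- then S × V(H) is a minimal kTDS of G □ H: the layer G × {h} through (g , h)
-- already contains k neighbors of (g , h), and if v′ ∉ S is an external private
-- neighbor of v, then no neighbor of (v′ , h) in {v′} × V(H) lies in S × V(H),
-- so (v′ , h) is a private neighbor of (v , h).  The other bound is symmetric.

{-# OPTIONS --safe #-}
module Submission where

open import Defs
open import Data.Nat.Base using (ℕ; _*_; _⊔_; _≥_)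

open import Data.Bool.Base using (true)
open import Data.Fin.Base using (Fin; zero; suc; combine; remQuot)
open import Data.Fin.Properties using (suc-injective; 0≢1+n; combine-remQuot; *↔×)
open import Data.Fin.Subset using (Subset; inside; outside; ∣_∣; _∩_; _∈_; _∉_; _⊂_; _-_; ⊤; ⊥)
open import Data.Fin.Subset.Properties
  using (∣⊤∣≡n; ∣⊥∣≡0; x∈p∩q⁺; x∈p∩q⁻; p⊂q⇒∣p∣<∣q∣; x∈p∧x≢y⇒x∈p-y; x∈p⇒∣p-x∣<∣p∣)
open import Data.List.Base using (map; filter)
open import Data.List.Extrema.Nat using (xs≤max)
open import Data.List.Membership.Propositional using () renaming (_∈_ to _∈ˡ_)
open import Data.List.Membership.Propositional.Properties
  using (∈-map⁺; ∈-filter⁺; ∈-++⁺ˡ; ∈-++⁺ʳ)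
open import Data.List.Relation.Unary.All using () renaming (lookup to lookupᴬ)
open import Data.List.Relation.Unary.Any using (here)
open import Data.Nat.Base using (suc; _+_; _≤_; z≤n; s≤s)
open import Data.Nat.Properties
  using (≤-trans; <-≤-trans; <⇒≱; ≤-reflexive; ≤-antisym; ⊔-lub; module ≤-Reasoning)
open import Data.Product.Algebra using (×-comm)
open import Data.Product.Base using (_×_; _,_; proj₁; proj₂; ∃-syntax)
open import Data.Sum.Base using (_⊎_; inj₁; inj₂; swap)
open import Data.Vec.Base
  using ([]; _∷_; _++_; concat; replicate; lookup; tabulate; here; there) renaming (map to mapᵛ)
open import Data.Vec.Properties
  using (lookup∘tabulate; lookup⇒[]=; []=⇒lookup; lookup-concat; lookup-map; lookup-replicate)
open import Function.Base using (_∘_)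
open import Function.Bundles using (_↔_; _⇔_; mk⇔; module Injection; module Inverse; module Equivalence)
open import Function.Construct.Composition using (_↔-∘_)
open import Function.Construct.Symmetry using (↔-sym)
open import Function.Properties.Inverse using (↔⇒↣)
open import Relation.Binary.PropositionalEquality
open import Relation.Nullary using (Dec; yes; no; does; contradiction)
open import Relation.Nullary.Decidable using (dec-true)

private
  variable
    k l m n : ℕ

-- Counting in finite subsets

∈-tabulate⁺ : ∀ {f : Fin n → _} {x} → f x ≡ true → x ∈ tabulate f
∈-tabulate⁺ {f = f} {x} eq = lookup⇒[]= x _ (trans (lookup∘tabulate f x) eq)

∈-tabulate⁻ : ∀ {f : Fin n → _} {x} → x ∈ tabulate f → f x ≡ true
∈-tabulate⁻ {f = f} {x} x∈ = trans (sym (lookup∘tabulate f x)) ([]=⇒lookup x∈)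

∣p++q∣≡∣p∣+∣q∣ : (p : Subset m) (q : Subset n) → ∣ p ++ q ∣ ≡ ∣ p ∣ + ∣ q ∣
∣p++q∣≡∣p∣+∣q∣ []            q = refl
∣p++q∣≡∣p∣+∣q∣ (inside  ∷ p) q = cong suc (∣p++q∣≡∣p∣+∣q∣ p q)
∣p++q∣≡∣p∣+∣q∣ (outside ∷ p) q = ∣p++q∣≡∣p∣+∣q∣ p q

-- Induction on `p`: an element at the head uses up its image `f zero`, and injectivity keeps the
-- images of the tail inside `q - f zero`, which is strictly smaller than `q`.
injectiveOn⇒∣p∣≤∣q∣ : (p : Subset m) (q : Subset n) (f : Fin m → Fin n) →
  (∀ {x} → x ∈ p → f x ∈ q) →
  (∀ {x y} → x ∈ p → y ∈ p → f x ≡ f y → x ≡ y) →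
  ∣ p ∣ ≤ ∣ q ∣
injectiveOn⇒∣p∣≤∣q∣ []            q f f∈ inj = z≤n
injectiveOn⇒∣p∣≤∣q∣ (outside ∷ p) q f f∈ inj =
  injectiveOn⇒∣p∣≤∣q∣ p q (f ∘ suc) (f∈ ∘ there)
    λ x∈ y∈ eq → suc-injective (inj (there x∈) (there y∈) eq)
injectiveOn⇒∣p∣≤∣q∣ (inside ∷ p) q f f∈ inj = ≤-trans
  (s≤s (injectiveOn⇒∣p∣≤∣q∣ p (q - f zero) (f ∘ suc)
    (λ x∈ → x∈p∧x≢y⇒x∈p-y (f∈ (there x∈))
      λ eq → 0≢1+n (sym (inj (there x∈) here eq)))
    λ x∈ y∈ eq → suc-injective (inj (there x∈) (there y∈) eq)))
  (x∈p⇒∣p-x∣<∣p∣ (f∈ here))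

-- The set p × Fin n in the row-major encoding of pairs. Block by block it is full or empty, which
-- makes its cardinality a plain induction.
cylinder : ∀ n → Subset m → Subset (m * n)
cylinder n p = concat (mapᵛ (replicate n) p)

∣cylinder∣ : ∀ n (p : Subset m) → ∣ cylinder n p ∣ ≡ ∣ p ∣ * n
∣cylinder∣ n []            = refl
∣cylinder∣ n (inside  ∷ p) =
  trans (∣p++q∣≡∣p∣+∣q∣ (⊤ {n}) _) (cong₂ _+_ (∣⊤∣≡n n) (∣cylinder∣ n p))
∣cylinder∣ n (outside ∷ p) =
  trans (∣p++q∣≡∣p∣+∣q∣ (⊥ {n}) _) (cong₂ _+_ (∣⊥∣≡0 n) (∣cylinder∣ n p))

lookup-cylinder : ∀ {m} n (p : Subset m) i →
  lookup (cylinder n p) i ≡ lookup p (proj₁ (remQuot {m} n i))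
lookup-cylinder {m} n p i = begin
  lookup (cylinder n p) i                         ≡⟨ cong (lookup (cylinder n p)) (combine-remQuot {m} n i) ⟨
  lookup (cylinder n p) (combine g h)             ≡⟨ lookup-concat (mapᵛ (replicate n) p) g h ⟩
  lookup (lookup (mapᵛ (replicate n) p) g) h      ≡⟨ cong (λ v → lookup v h) (lookup-map g (replicate n) p) ⟩
  lookup (replicate n (lookup p g)) h             ≡⟨ lookup-replicate h (lookup p g) ⟩
  lookup p g                                      ∎
  where
  open ≡-Reasoning
  g = proj₁ (remQuot {m} n i)
  h = proj₂ (remQuot {m} n i)

-- Neighborhoods and minimal kTDSs

does≡true⇒ : ∀ {A : Set} (a? : Dec A) → does a? ≡ true → A
does≡true⇒ (yes a) _ = a

∈-N⁺ : (G : Graph n) {x y : Fin n} → Adj G x y → y ∈ N G x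
∈-N⁺ G a = ∈-tabulate⁺ (dec-true (adj? G _ _) a)

∈-N⁻ : (G : Graph n) {x y : Fin n} → y ∈ N G x → Adj G x y
∈-N⁻ G y∈ = does≡true⇒ (adj? G _ _) (∈-tabulate⁻ y∈)

∈-subsets : (p : Subset n) → p ∈ˡ subsets n
∈-subsets []            = here refl
∈-subsets (inside  ∷ p) = ∈-++⁺ˡ (∈-map⁺ (inside ∷_) (∈-subsets p))
∈-subsets (outside ∷ p) = ∈-++⁺ʳ _ (∈-map⁺ (outside ∷_) (∈-subsets p))

minimal⇒∣S∣≤Γ : (G : Graph n) (S : Subset n) → IsMinimalTDS k G S → ∣ S ∣ ≤ Γ k G
minimal⇒∣S∣≤Γ {k = k} G S min = lookupᴬ
  (xs≤max 0 (map ∣_∣ (filter (isMinimalTDS? k G) (subsets _))))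
  (∈-map⁺ ∣_∣ (∈-filter⁺ (isMinimalTDS? k G) (∈-subsets S) min))

-- A proper subset `T` misses some `v` in `S`. The private neighbor of `v` has exactly `k` neighbors
-- in `S`, one of them `v`, so fewer than `k` remain in `T`.
privateNeighbors⇒minimal : (G : Graph n) (S : Subset n) → IsTDS k G S →
  (∀ v → v ∈ S → ∃[ v′ ] IsOpenPrivateNeighbor k G S v v′) → IsMinimalTDS k G S
privateNeighbors⇒minimal {k = k} G S tds pn = tds , not-TDS
  where
  not-TDS : ∀ T → T ⊂ S → IsTDS k G T → _
  not-TDS T (T⊆S , v , v∈S , v∉T) tdsT with v′ , v∈N , eq ← pn v v∈S =
    <⇒≱ (<-≤-trans (p⊂q⇒∣p∣<∣q∣ smaller) (≤-reflexive eq)) (tdsT v′)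
    where
    smaller : N G v′ ∩ T ⊂ N G v′ ∩ S
    smaller =
        (λ x∈ → let x∈N , x∈T = x∈p∩q⁻ (N G v′) T x∈ in x∈p∩q⁺ (x∈N , T⊆S x∈T))
      , v , x∈p∩q⁺ (v∈N , v∈S) , λ v∈ → v∉T (proj₂ (x∈p∩q⁻ (N G v′) T v∈))

-- Working with any graph isomorphic to the Cartesian product lets the two
-- factors of G □ H be exchanged.
record IsCartesianProduct (G : Graph m) (H : Graph n) (K : Graph l) : Set where
  field
    vertices : Fin l ↔ (Fin m × Fin n)

  open Inverse vertices public using (to; from; strictlyInverseˡ; strictlyInverseʳ)

  fst : Fin l → Fin m
  fst x = proj₁ (to x)

  snd : Fin l → Fin n
  snd x = proj₂ (to x)

  field
    adj⇔ : ∀ x y → Adj K x y ⇔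
      ((fst x ≡ fst y × Adj H (snd x) (snd y)) ⊎ (snd x ≡ snd y × Adj G (fst x) (fst y)))

  to-injective : ∀ {x y} → fst x ≡ fst y → snd x ≡ snd y → x ≡ y
  to-injective {x} {y} p q =
    trans (sym (strictlyInverseʳ x)) (trans (cong from (cong₂ _,_ p q)) (strictlyInverseʳ y))

  fst-from : ∀ g h → fst (from (g , h)) ≡ g
  fst-from g h = cong proj₁ (strictlyInverseˡ (g , h))

  snd-from : ∀ g h → snd (from (g , h)) ≡ h
  snd-from g h = cong proj₂ (strictlyInverseˡ (g , h))

□-isCartesianProduct : (G : Graph m) (H : Graph n) → IsCartesianProduct G H (G □ H)
□-isCartesianProduct G H = record
  { vertices = *↔×
  -- The forward map of `*↔×` is `remQuot`, whose components are `quotient` and `remainder`, so both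
  -- sides agree by definition.
  ; adj⇔     = λ _ _ → mk⇔ (λ a → a) (λ a → a)
  }

IsCartesianProduct-swap : {G : Graph m} {H : Graph n} {K : Graph l} →
  IsCartesianProduct G H K → IsCartesianProduct H G K
IsCartesianProduct-swap P = record
  { vertices = ×-comm _ _ ↔-∘ vertices
  ; adj⇔     = λ x y → let open Equivalence (adj⇔ x y) renaming (to to ⇒; from to ⇐) in
                 mk⇔ (swap ∘ ⇒) (⇐ ∘ swap)
  }
  where open IsCartesianProduct P

-- Pulling a kTDS of one factor back to the product

module _ {G : Graph m} {H : Graph n} {K : Graph l} (P : IsCartesianProduct G H K)
         (S : Subset m) where
  open IsCartesianProduct P

  preimage : Subset l
  preimage = tabulate (lookup S ∘ fst)

  ∈-preimage⁺ : ∀ {x} → fst x ∈ S → x ∈ preimage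
  ∈-preimage⁺ = ∈-tabulate⁺ ∘ []=⇒lookup

  ∈-preimage⁻ : ∀ {x} → x ∈ preimage → fst x ∈ S
  ∈-preimage⁻ = lookup⇒[]= _ S ∘ ∈-tabulate⁻

  from-∈-preimage : ∀ {g} h → g ∈ S → from (g , h) ∈ preimage
  from-∈-preimage {g} h g∈S = ∈-preimage⁺ (subst (_∈ S) (sym (fst-from g h)) g∈S)

  ∣S∣*n≤∣preimage∣ : ∣ S ∣ * n ≤ ∣ preimage ∣
  ∣S∣*n≤∣preimage∣ = ≤-trans (≤-reflexive (sym (∣cylinder∣ n S)))
    -- The map re-encodes a pair from row-major order into the vertices of `K`; it is injective as a
    -- composite of two bijections.
    (injectiveOn⇒∣p∣≤∣q∣ (cylinder n S) preimage (from ∘ remQuot {m} n)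
      (λ {i} i∈ → from-∈-preimage _
        (lookup⇒[]= _ S (trans (sym (lookup-cylinder n S i)) ([]=⇒lookup i∈))))
      λ _ _ → Injection.injective (↔⇒↣ (↔-sym vertices ↔-∘ *↔×)))

  layer-neighbor : ∀ {x g} → Adj G (fst x) g → Adj K x (from (g , snd x))
  layer-neighbor {x} {g} a = Equivalence.from (adj⇔ x _)
    (inj₂ (sym (snd-from g (snd x)) , subst (Adj G (fst x)) (sym (fst-from g (snd x))) a))

  preimage-TDS : IsTDS k G S → IsTDS k K preimage
  preimage-TDS tds x = ≤-trans (tds (fst x))
    (injectiveOn⇒∣p∣≤∣q∣ _ _ (λ g → from (g , snd x))
      (λ g∈ → let g∈N , g∈S = x∈p∩q⁻ (N G (fst x)) S g∈ in
        x∈p∩q⁺ (∈-N⁺ K (layer-neighbor (∈-N⁻ G g∈N)) , from-∈-preimage _ g∈S))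
      λ _ _ eq → trans (sym (fst-from _ _)) (trans (cong fst eq) (fst-from _ _)))

  -- An edge in the `H` direction keeps the first coordinate, so its other end would also project
  -- outside `S`. Only edges in the `G` direction remain.
  neighbors-in-layer : ∀ {x y} → fst x ∉ S → y ∈ N K x ∩ preimage →
    snd x ≡ snd y × Adj G (fst x) (fst y)
  neighbors-in-layer {x} {y} x∉S y∈ with y∈N , y∈S ← x∈p∩q⁻ (N K x) preimage y∈
    with Equivalence.to (adj⇔ x y) (∈-N⁻ K y∈N)
  ... | inj₁ (eq , _) = contradiction (subst (_∈ S) (sym eq) (∈-preimage⁻ y∈S)) x∉S
  ... | inj₂ a        = a

  -- These neighbors all share the second coordinate of `x`, so the first projection is injective on
  -- them.
  ∣N∩preimage∣≤∣N∩S∣ : ∀ x → fst x ∉ S → ∣ N K x ∩ preimage ∣ ≤ ∣ N G (fst x) ∩ S ∣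
  ∣N∩preimage∣≤∣N∩S∣ x x∉S = injectiveOn⇒∣p∣≤∣q∣ _ _ fst
    (λ y∈ → x∈p∩q⁺ ( ∈-N⁺ G (proj₂ (neighbors-in-layer x∉S y∈))
                   , ∈-preimage⁻ (proj₂ (x∈p∩q⁻ (N K x) preimage y∈))))
    λ y∈ z∈ eq → to-injective eq
      (trans (sym (proj₁ (neighbors-in-layer x∉S y∈))) (proj₁ (neighbors-in-layer x∉S z∈)))

  preimage-privateNeighbor : IsTDS k G S →
    (∀ v → v ∈ S → ∃[ v′ ] IsOpenPrivateNeighbor k G S v v′ × v′ ∉ S) →
    ∀ x → x ∈ preimage → ∃[ x′ ] IsOpenPrivateNeighbor k K preimage x x′
  preimage-privateNeighbor {k = k} tds ext x x∈ with ext (fst x) (∈-preimage⁻ x∈)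
  -- The witness is the copy of `v′` in the layer of `x`. It has at least `k` neighbors in
  -- `preimage` by total domination, and at most `k` because `v′` is external.
  ... | v′ , (v∈N , eq) , v′∉S = x′ , ∈-N⁺ K x′~x , ≤-antisym upper (preimage-TDS tds x′)
    where
    x′ = from (v′ , snd x)
    fst-x′ = fst-from v′ (snd x)

    x′~x : Adj K x′ x
    -- `layer-neighbor` produces edges starting at `x`, hence a reversal in `G` and another in `K`.
    x′~x = adj-sym K (layer-neighbor (adj-sym G (∈-N⁻ G v∈N)))

    upper : ∣ N K x′ ∩ preimage ∣ ≤ k
    upper = begin
      ∣ N K x′ ∩ preimage ∣   ≤⟨ ∣N∩preimage∣≤∣N∩S∣ x′ (subst (_∉ S) (sym fst-x′) v′∉S) ⟩
      ∣ N G (fst x′) ∩ S ∣    ≡⟨ cong (λ g → ∣ N G g ∩ S ∣) fst-x′ ⟩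
      ∣ N G v′ ∩ S ∣          ≡⟨ eq ⟩
      k                       ∎
      where open ≤-Reasoning

Γ-external-product : {G : Graph m} {H : Graph n} {K : Graph l} →
  IsCartesianProduct G H K → IsExternal k G → Γ k G * n ≤ Γ k K
Γ-external-product {n = n} {k = k} {G = G} {K = K} P (S , ((tds , _) , ∣S∣≡Γ) , ext) = begin
  Γ k G * n             ≡⟨ cong (_* n) ∣S∣≡Γ ⟨
  ∣ S ∣ * n             ≤⟨ ∣S∣*n≤∣preimage∣ P S ⟩
  ∣ preimage P S ∣      ≤⟨ minimal⇒∣S∣≤Γ K _ (privateNeighbors⇒minimal K _
                             (preimage-TDS P S tds) (preimage-privateNeighbor P S tds ext)) ⟩
  Γ k K                 ∎
  where open ≤-Reasoning

mainTheorem10 : (k : ℕ) → k ≥ 2 →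
    (m n : ℕ) (G : Graph m) (H : Graph n) →
    IsExternal k G → IsExternal k H →
    δ G ≥ k → δ H ≥ k →
    Γ k (G □ H) ≥ (Γ k G * n) ⊔ (Γ k H * m)
mainTheorem10 k _ m n G H extG extH _ _ = ⊔-lub
  (Γ-external-product P extG)
  -- The same graph `G □ H` is read as a product of `H` and `G`.
  (Γ-external-product (IsCartesianProduct-swap P) extH)
  where P = □-isCartesianProduct G H
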